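{- Let $k\ge 1$ be any fixed integer constant and let $\alpha$ be any real constant. Any non-adaptive randomized algorithm that, with probability at least $2/3$, $\alpha$-estimates the number of defective items in a set of $n$ items (that is, for every set of defective items $I$, returns with probability at least $2/3$ an estimate of $|I|$ to within the constant factor $\alpha$) must make at least $$\Omega\left(\frac{\log n}{\log^{[k]} n}\right)$$ tests. Here $\Omega(\cdot)$ is as $n\to\infty$: there exist $c>0$ and $n_0$, depending only on $\alpha$ and $k$, such that for all $n\ge n_0$ any such algorithm makes at least $c\,\log n/\log^{[k]}n$ tests on $n$ items.
   Context: Group testing. The set of items is $X=[n]=\{1,\dots,n\}$ and an unknown set $I\subseteq X$ is the set of defective items. A test is a subset $Q\subseteq X$; its answer is $\mathcal{O}_I(Q)=1$ if $Q\cap I\neq\emptyset$ and $\mathcal{O}_I(Q)=0$ otherwise. The algorithm knows $n$ and accesses $I$ only through the test oracle $\mathcal{O}_I$. A randomized algorithm is non-adaptive if its tests do not depend on the answers to other tests. That is, using its random seed only (and $n$), it chooses a (random) collection of tests $Q_1,\dots,Q_s$, receives all the answers $\mathcal{O}_I(Q_1),\dots,\mathcal{O}_I(Q_s)$ simultaneously, and produces an output depending on the seed and these answers. The number of tests it makes is $s=s(n)$. An algorithm $A$, with probability at least $1-\delta$, $\alpha$-estimates the number of defective items if, for every $I\subseteq X$, $A$ runs in time polynomial in $n$, makes tests with the oracle $\mathcal{O}_I$, and, with probability at least $1-\delta$ (over its own randomness), returns an integer $D$ such that $|I|\le D\le\alpha|I|$. Logarithms are to base 2. Write $\log^{[0]}n=n$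 and $\log^{[k]}n=\log(\log^{[k-1]}n)$ for $k\ge1$ (the $k$-fold iterated logarithm $\log\log\cdots\log n$). -}

module Defs where

import Algebra.Definitions.RawSemiring
open import Data.Bool.Base using (Bool; if_then_else_)
open import Data.Fin.Base using (Fin)
open import Data.Fin.Subset using (Subset; ∣_∣; _∩_; _∈_)
open import Data.Fin.Subset.Properties using (nonempty?)
open import Data.Integer.Base as ℤ using (ℤ; +_; -[1+_])
open import Data.Nat.Base using (ℕ; zero; suc)
open import Data.Product.Base using (∃; ∃₂; _×_)
open import Data.Rational.Base
  using (ℚ; 0ℚ; 1ℚ; ½; ↥_; ↧ₙ_; _+_; _*_; _≤_; _<_; _/_; +-*-rawSemiring)
open import Data.Vec.Base using (Vec; lookup; map)
open import Level using (0ℓ)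
open import Relation.Binary.PropositionalEquality.Core using (_≡_)
open import Relation.Nullary.Decidable.Core using (does)
open import Relation.Nullary.Negation.Core using (¬_)
open import Relation.Unary using (Pred; _⊆_)

open Algebra.Definitions.RawSemiring +-*-rawSemiring using (sum; _^_)

-- Real numbers are (one-sided) Dedekind cuts: x is represented by
-- { q ∈ ℚ ∣ q < x }; constructively these are the bounded lower reals.
-- The operations below are defined on arbitrary sets of rationals, so that
-- log is total: log x = ∅, i.e. -∞, when x ≤ 0.

Cut : Set₁
Cut = Pred ℚ 0ℓ

record IsReal (x : Cut) : Set where
  field
    inhabited : ∃ x
    bounded   : ∃ λ q → ¬ x q
    downward  : ∀ {p q} → p < q → x q → x p
    open-end  : ∀ {p} → x p → ∃ λ q → p < q × x q

infix 4 _≤ᶜ_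

_≤ᶜ_ : Cut → Cut → Set
x ≤ᶜ y = x ⊆ y

fromℚ : ℚ → Cut
fromℚ p q = q < p

fromℤ : ℤ → Cut
fromℤ z = fromℚ (z / 1)

fromℕ : ℕ → Cut
fromℕ n = fromℤ (+ n)

infixr 7 _·_

-- The product c x, for rational c ≥ 0.
_·_ : ℚ → Cut → Cut
(c · x) q = ∃ λ r → x r × q < c * r

infixl 7 _÷_

-- The quotient x / y, for x ≥ 0 and y > 0: q < x / y iff q t < r for some
-- rationals r < x and t ≥ y.
_÷_ : Cut → Cut → Cut
(x ÷ y) q = ∃₂ λ r t → x r × 0ℚ < t × ¬ y t × q * t < r

2^_ : ℤ → ℚ
2^ (+ n)    = (1ℚ + 1ℚ) ^ n
2^ -[1+ n ] = ½ ^ suc n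

-- The logarithm to base 2: a / b < log x iff 2 ^ a < r ^ b for some rational
-- 0 < r < x.
log : Cut → Cut
log x q = ∃ λ r → x r × 0ℚ < r × 2^ (↥ q) < r ^ (↧ₙ q)

log^[_] : ℕ → Cut → Cut
log^[ zero  ] x = x
log^[ suc k ] x = log (log^[ k ] x)

𝒪 : ∀ {n} → Subset n → Subset n → Bool
𝒪 I Q = does (nonempty? (Q ∩ I))

-- Non-adaptive randomized algorithms on n items making s tests.  The seed is
-- drawn from a finite probability space with rational weights (e.g. a string
-- of fair coin flips); running time is not bounded.
record Algorithm (n s : ℕ) : Set where
  field
    seeds         : ℕ
    weight        : Fin seeds → ℚ
    weight-nonNeg : ∀ ω → 0ℚ ≤ weight ω
    weight-total  : sum weight ≡ 1ℚ
    tests         : Fin seeds → Vec (Subset n) s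
    output        : Fin seeds → Vec Bool s → ℤ

  run : Subset n → Fin seeds → ℤ
  run I ω = output ω (map (𝒪 I) (tests ω))

  probability : Subset seeds → ℚ
  probability G = sum λ ω → if lookup G ω then weight ω else 0ℚ

  -- P holds with probability at least p.  As P need not be decidable, this is
  -- expressed by a decidable event of probability at least p contained in P.
  WithProbability≥ : ℚ → Pred (Fin seeds) 0ℓ → Set
  WithProbability≥ p P = ∃ λ G → p ≤ probability G × (∀ {ω} → ω ∈ G → P ω)

Estimates : ∀ {n s} → ℚ → Cut → Algorithm n s → Set
Estimates {n} p α A =
  ∀ (I : Subset n) → WithProbability≥ p λ ω →
    (+ ∣ I ∣ ℤ.≤ run I ω) × (fromℤ (run I ω) ≤ᶜ (+ ∣ I ∣ / 1) · α)
  where open Algorithm A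

{-# OPTIONS --safe #-}

-- Let I₀ ⊂ I₁ ⊂ … be initial segments of the items, of sizes 1, B, B², …
-- for a constant B > α.  For a fixed seed the vectors of answers increase
-- along this chain, so at most s + 1 of them are distinct, and a given vector
-- of answers leads to an output that is correct for at most one Iⱼ.  Hence at
-- most s + 1 of the M chain members are estimated correctly under each seed;
-- averaging over the seeds, (2/3) M ≤ s + 1.  Since M is of order log n, this
-- gives s = Ω(log n), and log^[k] n ≥ 1 for large n.

module Submission where

open import Defs
open import Data.Nat.Base using (ℕ; _≥_)
open import Data.Integer.Base using (+_)
open import Data.Product.Base using (∃₂; _×_)
open import Data.Rational.Base using (ℚ; 0ℚ; _<_; _/_)

import Algebra.Definitions.RawSemiring
import Algebra.Properties.Semiring.Exp
import Algebra.Properties.Semiring.Mult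
import Algebra.Properties.Semiring.Sum
open import Algebra.Bundles using (CommutativeRing)
open import Data.Bool.Base using (Bool; true; false; if_then_else_)
open import Data.Fin.Base as Fin using (Fin; zero; suc; toℕ)
import Data.Fin.Properties as Fin
open import Data.Fin.Subset using (Subset; inside; outside; ⊥; ∣_∣; _∩_; _⊆_)
open import Data.Fin.Subset.Properties
  using (nonempty?; ∣p∣≤n; ∣⊥∣≡0; ⊥⊆; drop-∷-⊆; s⊆s; out⊆; p⊆q⇒∣p∣≤∣q∣; x∈p∩q⁺; x∈p∩q⁻)
open import Data.Integer.Base as ℤ using (ℤ; -[1+_])
import Data.Integer.Properties as ℤ
open import Data.Nat.Base as ℕ using (zero; suc; z≤n; s≤s)
import Data.Nat.Coprimality as Coprimality
import Data.Nat.Properties as ℕ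
open import Data.Nat.Tactic.RingSolver using (solve-∀)
open import Data.Product.Base using (∃; _,_; proj₁; proj₂)
open import Data.Rational.Base
  using (mkℚ; 1ℚ; ½; ↥_; ↧_; ↧ₙ_; _+_; _*_; _≤_; *<*; *≤*; 1/_; nonNegative; +-*-rawSemiring)
open import Data.Rational.Properties
open import Data.Sum.Base using (_⊎_; inj₁; inj₂)
open import Data.Vec.Base using (Vec; []; _∷_; lookup; map; here; there)
open import Data.Vec.Properties using (lookup⇒[]=)
open import Function.Base using (_∘_)
open import Relation.Binary.PropositionalEquality
  using (_≡_; refl; sym; trans; cong; cong₂; subst; module ≡-Reasoning)
open import Relation.Nullary.Decidable using (yes; no)
open import Relation.Nullary.Negation using (¬_; contradiction)

open Algebra.Definitions.RawSemiring +-*-rawSemiring using (sum; _^_) renaming (_×_ to _∙_)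

private
  module R = CommutativeRing +-*-commutativeRing
  module Σℚ = Algebra.Properties.Semiring.Sum R.semiring
  module Mult = Algebra.Properties.Semiring.Mult R.semiring
  module Exp = Algebra.Properties.Semiring.Exp R.semiring

-- Integers as rationals

-- `z / 1` normalises by a gcd and is stuck for a variable `z`. Rewriting with this equation exposes
-- the denominator 1, so that order and arithmetic reduce to those of integers.
z/1≡mkℚ : ∀ z → z / 1 ≡ mkℚ z 0 (Coprimality.sym (Coprimality.1-coprimeTo ℤ.∣ z ∣))
z/1≡mkℚ z = ↥p/↧p≡p (mkℚ z 0 _)

/1-mono-≤ : ∀ {i j} → i ℤ.≤ j → i / 1 ≤ j / 1
/1-mono-≤ {i} {j} i≤j rewrite z/1≡mkℚ i | z/1≡mkℚ j = *≤* (ℤ.*-monoʳ-≤-nonNeg (+ 1) i≤j)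

0≤/1 : ∀ n → 0ℚ ≤ + n / 1
0≤/1 n = /1-mono-≤ {+ 0} {+ n} (ℤ.+≤+ z≤n)

/1-cancel-≤ : ∀ {i j} → i / 1 ≤ j / 1 → i ℤ.≤ j
/1-cancel-≤ {i} {j} i≤j rewrite z/1≡mkℚ i | z/1≡mkℚ j with *≤* h ← i≤j = ℤ.*-cancelʳ-≤-pos i j (+ 1) h

/1-mono-< : ∀ {i j} → i ℤ.< j → i / 1 < j / 1
/1-mono-< {i} {j} i<j rewrite z/1≡mkℚ i | z/1≡mkℚ j = *<* (ℤ.*-monoʳ-<-pos (+ 1) i<j)

</1⁺ : ∀ q z → ↥ q ℤ.< z ℤ.* ↧ q → q < z / 1
</1⁺ q z h rewrite z/1≡mkℚ z = *<* (subst (ℤ._< z ℤ.* ↧ q) (sym (ℤ.*-identityʳ (↥ q))) h)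

</1⁻ : ∀ q z → q < z / 1 → ↥ q ℤ.< z ℤ.* ↧ q
</1⁻ q z h rewrite z/1≡mkℚ z with *<* h′ ← h = subst (ℤ._< z ℤ.* ↧ q) (ℤ.*-identityʳ (↥ q)) h′

≤/1⁻ : ∀ q z → z / 1 ≤ q → z ℤ.* ↧ q ℤ.≤ ↥ q
≤/1⁻ q z z≤q = ℤ.≮⇒≥ λ h → <-irrefl refl (<-≤-trans (</1⁺ q z h) z≤q)

/1-homo-+ : ∀ i j → (i ℤ.+ j) / 1 ≡ i / 1 + j / 1
/1-homo-+ i j rewrite z/1≡mkℚ i | z/1≡mkℚ j =
  cong (_/ 1) (cong₂ ℤ._+_ (sym (ℤ.*-identityʳ i)) (sym (ℤ.*-identityʳ j)))

/1-homo-* : ∀ i j → (i ℤ.* j) / 1 ≡ (i / 1) * (j / 1)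
/1-homo-* i j rewrite z/1≡mkℚ i | z/1≡mkℚ j = refl

pos-/1-homo-* : ∀ m n → + (m ℕ.* n) / 1 ≡ (+ m / 1) * (+ n / 1)
pos-/1-homo-* m n = trans (cong (_/ 1) (ℤ.pos-* m n)) (/1-homo-* (+ m) (+ n))

∙1≡/1 : ∀ n → n ∙ 1ℚ ≡ + n / 1
∙1≡/1 zero    = refl
∙1≡/1 (suc n) = trans (cong (λ x → 1ℚ + x) (∙1≡/1 n)) (sym (/1-homo-+ (+ 1) (+ n)))

∙≡/1* : ∀ n q → n ∙ q ≡ (+ n / 1) * q
∙≡/1* n q = begin
  n ∙ q          ≡⟨ cong (n ∙_) (*-identityˡ q) ⟨
  n ∙ (1ℚ * q)   ≡⟨ Mult.×-assoc-* n 1ℚ q ⟨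
  (n ∙ 1ℚ) * q   ≡⟨ cong (_* q) (∙1≡/1 n) ⟩
  (+ n / 1) * q  ∎
  where open ≡-Reasoning

archimedean : ∀ q → ∃ λ n → q < + n / 1
archimedean q@(mkℚ z d _) = suc ℤ.∣ z ∣ , </1⁺ q (+ suc ℤ.∣ z ∣) (begin-strict
  z                              ≤⟨ i≤∣i∣ z ⟩
  + ℤ.∣ z ∣                      <⟨ ℤ.+<+ (ℕ.n<1+n _) ⟩
  + suc ℤ.∣ z ∣                  ≤⟨ ℤ.+≤+ (ℕ.m≤m*n (suc ℤ.∣ z ∣) (suc d)) ⟩
  + (suc ℤ.∣ z ∣ ℕ.* suc d)      ≡⟨ ℤ.pos-* (suc ℤ.∣ z ∣) (suc d) ⟩
  (+ suc ℤ.∣ z ∣) ℤ.* (+ suc d)  ∎)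
  where
  open ℤ.≤-Reasoning
  i≤∣i∣ : ∀ i → i ℤ.≤ + ℤ.∣ i ∣
  i≤∣i∣ (+ _)    = ℤ.≤-refl
  i≤∣i∣ -[1+ _ ] = ℤ.-≤+

-- Powers

2ℚ : ℚ
2ℚ = 1ℚ + 1ℚ

2ℚ^ : ∀ n → 2ℚ ^ n ≡ + (2 ℕ.^ n) / 1
2ℚ^ zero    = refl
2ℚ^ (suc n) = trans (cong (2ℚ *_) (2ℚ^ n)) (sym (pos-/1-homo-* 2 (2 ℕ.^ n)))

2ℚ^-mono-≤ : ∀ {m n} → m ℕ.≤ n → 2ℚ ^ m ≤ 2ℚ ^ n
2ℚ^-mono-≤ {m} {n} m≤n rewrite 2ℚ^ m | 2ℚ^ n = /1-mono-≤ (ℤ.+≤+ (ℕ.^-monoʳ-≤ 2 m≤n))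

2ℚ^-mono-< : ∀ {m n} → m ℕ.< n → 2ℚ ^ m < 2ℚ ^ n
2ℚ^-mono-< {m} {n} m<n rewrite 2ℚ^ m | 2ℚ^ n = /1-mono-< (ℤ.+<+ (ℕ.^-monoʳ-< 2 (s≤s (s≤s z≤n)) m<n))

0≤1 : 0ℚ ≤ 1ℚ
0≤1 = nonNegative⁻¹ 1ℚ

*-mono-≤-nonNeg : ∀ {p q r s} → 0ℚ ≤ r → 0ℚ ≤ q → p ≤ q → r ≤ s → p * r ≤ q * s
*-mono-≤-nonNeg {p} {q} {r} {s} 0≤r 0≤q p≤q r≤s = ≤-trans
  (*-monoʳ-≤-nonNeg r {{nonNegative 0≤r}} p≤q) (*-monoˡ-≤-nonNeg q {{nonNegative 0≤q}} r≤s)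

^-nonNeg : ∀ {x} n → 0ℚ ≤ x → 0ℚ ≤ x ^ n
^-nonNeg zero    0≤x = 0≤1
^-nonNeg {x} (suc n) 0≤x = *-mono-≤-nonNeg {0ℚ} {x} {0ℚ} ≤-refl 0≤x 0≤x (^-nonNeg n 0≤x)

^-mono-≤ : ∀ {x y} n → 0ℚ ≤ x → x ≤ y → x ^ n ≤ y ^ n
^-mono-≤ zero    0≤x x≤y = ≤-refl
^-mono-≤ (suc n) 0≤x x≤y =
  *-mono-≤-nonNeg (^-nonNeg n 0≤x) (≤-trans 0≤x x≤y) x≤y (^-mono-≤ n 0≤x x≤y)

½^≤1 : ∀ n → ½ ^ n ≤ 1ℚ
½^≤1 zero    = ≤-refl
½^≤1 (suc n) = *-mono-≤-nonNeg {½} {1ℚ} {½ ^ n} (^-nonNeg n (nonNegative⁻¹ ½)) 0≤1 (<⇒≤ ½<1) (½^≤1 n)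
  where
  ½<1 : ½ < 1ℚ
  ½<1 = *<* (ℤ.+<+ (s≤s (s≤s z≤n)))

2^-mono-<-pos : ∀ {z n} → z ℤ.< + n → 2^ z < 2ℚ ^ n
2^-mono-<-pos {+ m} (ℤ.+<+ m<n) = 2ℚ^-mono-< m<n
2^-mono-<-pos { -[1+ m ] } {n} _ = begin-strict
  ½ * ½ ^ m  ≤⟨ *-monoˡ-≤-nonNeg ½ (½^≤1 m) ⟩
  ½ * 1ℚ     <⟨ *<* (ℤ.+<+ (s≤s (s≤s z≤n))) ⟩
  2ℚ ^ 0     ≤⟨ 2ℚ^-mono-≤ {0} {n} z≤n ⟩
  2ℚ ^ n     ∎
  where open ≤-Reasoning

2^-mono-≤-pos : ∀ {n z} → + n ℤ.≤ z → 2ℚ ^ n ≤ 2^ z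
2^-mono-≤-pos (ℤ.+≤+ n≤m) = 2ℚ^-mono-≤ n≤m

-- Bounds on logarithms

-- If `r ≥ L`, a witness `ρ < n ≤ 2 ^ L` of `r < log n` would give `2^ (↥ r) < ρ ^ ↧ₙ r ≤ 2 ^ (L *
-- ↧ₙ r) ≤ 2^ (↥ r)`.
log-upper : ∀ {n} L {r} → n ℕ.≤ 2 ℕ.^ L → log (fromℕ n) r → r < + L / 1
log-upper {n} L {r} n≤2^L (ρ , ρ<n , 0<ρ , 2^<ρ^) with r <? + L / 1
... | yes r<L = r<L
... | no  r≮L = contradiction (begin-strict
  2^ (↥ r)           <⟨ 2^<ρ^ ⟩
  ρ ^ ↧ₙ r           ≤⟨ ^-mono-≤ (↧ₙ r) (<⇒≤ 0<ρ) ρ≤2^L ⟩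
  (2ℚ ^ L) ^ ↧ₙ r    ≡⟨ Exp.^-assocʳ 2ℚ L (↧ₙ r) ⟩
  2ℚ ^ (L ℕ.* ↧ₙ r)  ≤⟨ 2^-mono-≤-pos L*↧r≤↥r ⟩
  2^ (↥ r)           ∎) (<-irrefl refl)
  where
  open ≤-Reasoning
  ρ≤2^L : ρ ≤ 2ℚ ^ L
  ρ≤2^L = subst (ρ ≤_) (sym (2ℚ^ L)) (≤-trans (<⇒≤ ρ<n) (/1-mono-≤ (ℤ.+≤+ n≤2^L)))
  L*↧r≤↥r : + (L ℕ.* ↧ₙ r) ℤ.≤ ↥ r
  L*↧r≤↥r = subst (ℤ._≤ ↥ r) (sym (ℤ.pos-* L (↧ₙ r))) (≤/1⁻ r (+ L) (≮⇒≥ r≮L))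

log-lower : ∀ {x} b {q} → x (2ℚ ^ b) → q < + b / 1 → log x q
log-lower {x} b {q} x∋2^b q<b =
  2ℚ ^ b , x∋2^b , <-≤-trans (positive⁻¹ 1ℚ) (2ℚ^-mono-≤ {0} {b} z≤n) ,
  subst (2^ (↥ q) <_) (sym (Exp.^-assocʳ 2ℚ b (↧ₙ q)))
    (2^-mono-<-pos (subst (↥ q ℤ.<_) (sym (ℤ.pos-* b (↧ₙ q))) (</1⁻ q (+ b) q<b)))

-- A logarithm exceeds `q` as soon as its argument exceeds `2 ^ b` for a natural `b > q`, so the
-- induction on `k` passes from `q` to `2ℚ ^ b`.
log^[]-unbounded : ∀ k q → ∃ λ n₀ → ∀ n → n ≥ n₀ → log^[ k ] (fromℕ n) q
log^[]-unbounded zero q with archimedean q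
... | n₀ , q<n₀ = n₀ , λ n n≥n₀ → <-≤-trans q<n₀ (/1-mono-≤ (ℤ.+≤+ n≥n₀))
log^[]-unbounded (suc k) q with archimedean q
... | b , q<b with log^[]-unbounded k (2ℚ ^ b)
... | n₀ , h = n₀ , λ n n≥n₀ → log-lower b (h n n≥n₀) q<b

-- Sums

sum-mono-≤ : ∀ {n} {f g : Fin n → ℚ} → (∀ i → f i ≤ g i) → sum f ≤ sum g
sum-mono-≤ {zero}  f≤g = ≤-refl
sum-mono-≤ {suc n} f≤g = +-mono-≤ (f≤g zero) (sum-mono-≤ (f≤g ∘ suc))

∙-nonNeg : ∀ n {w} → 0ℚ ≤ w → 0ℚ ≤ n ∙ w
∙-nonNeg zero    0≤w = ≤-refl
∙-nonNeg (suc n) 0≤w = +-mono-≤ 0≤w (∙-nonNeg n 0≤w)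

-- The values φ j with g j true are distinct and lie in (s - k , s].
strictlyIncreasing⇒sum≤ : ∀ {m s} k (φ : Fin m → ℕ) (g : Fin m → Bool) {w} → 0ℚ ≤ w →
  (∀ j → φ j ℕ.≤ s) →
  (∀ j → g j ≡ true → s ℕ.< φ j ℕ.+ k) →
  (∀ {i j} → i Fin.< j → g i ≡ true → g j ≡ true → φ i ℕ.< φ j) →
  sum (λ j → if g j then w else 0ℚ) ≤ k ∙ w
strictlyIncreasing⇒sum≤ {zero} k φ g 0≤w φ≤s s<φ+k φ-mono = ∙-nonNeg k 0≤w
strictlyIncreasing⇒sum≤ {suc m} {s} k φ g {w} 0≤w φ≤s s<φ+k φ-mono with g zero in g₀
... | false = subst (_≤ k ∙ w) (sym (+-identityˡ _))
  (strictlyIncreasing⇒sum≤ k (φ ∘ suc) (g ∘ suc) 0≤w (φ≤s ∘ suc) (s<φ+k ∘ suc) (φ-mono ∘ s≤s))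
... | true with k
...   | zero = contradiction (ℕ.≤-trans (s<φ+k zero g₀) (ℕ.≤-reflexive (ℕ.+-identityʳ _))) (ℕ.≤⇒≯ (φ≤s zero))
...   | suc k = +-monoʳ-≤ w
  (strictlyIncreasing⇒sum≤ k (φ ∘ suc) (g ∘ suc) 0≤w (φ≤s ∘ suc)
    -- Later good values are at least `φ zero + 1`, so they keep the lower bound with `k` reduced by
    -- one; the removed unit pays for the `w` of the head.
    (λ j gⱼ → ℕ.<-≤-trans (s<φ+k zero g₀)
      (ℕ.≤-trans (ℕ.≤-reflexive (ℕ.+-suc (φ zero) k)) (ℕ.+-monoˡ-≤ k (φ-mono {zero} {suc j} (s≤s z≤n) g₀ gⱼ))))
    (φ-mono ∘ s≤s))

-- Subsets and answers

initial : ∀ {n} → ℕ → Subset n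
initial {zero}  _       = []
initial {suc n} zero    = ⊥
initial {suc n} (suc m) = inside ∷ initial m

∣initial∣ : ∀ {n m} → m ℕ.≤ n → ∣ initial {n} m ∣ ≡ m
∣initial∣ {zero}  z≤n       = refl
∣initial∣ {suc n} z≤n       = ∣⊥∣≡0 n
∣initial∣ {suc n} (s≤s m≤n) = cong suc (∣initial∣ m≤n)

initial-mono : ∀ {n i j} → i ℕ.≤ j → initial {n} i ⊆ initial j
initial-mono {zero}  _         = λ x∈ → x∈
initial-mono {suc n} z≤n       = ⊥⊆
initial-mono {suc n} (s≤s i≤j) = s⊆s (initial-mono i≤j)

-- Applied to vectors of answers, which are subsets since `Subset s` is `Vec Bool s`: the number of
-- positive answers then tells distinct members of a chain apart.
⊆⇒≡⊎∣∣< : ∀ {n} {p q : Subset n} → p ⊆ q → p ≡ q ⊎ ∣ p ∣ ℕ.< ∣ q ∣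
⊆⇒≡⊎∣∣< {p = []} {[]} _ = inj₁ refl
⊆⇒≡⊎∣∣< {p = true ∷ p} {false ∷ q} p⊆q with () ← p⊆q here
⊆⇒≡⊎∣∣< {p = false ∷ p} {true ∷ q} p⊆q = inj₂ (s≤s (p⊆q⇒∣p∣≤∣q∣ (drop-∷-⊆ p⊆q)))
⊆⇒≡⊎∣∣< {p = true ∷ p} {true ∷ q} p⊆q with ⊆⇒≡⊎∣∣< (drop-∷-⊆ p⊆q)
... | inj₁ p≡q = inj₁ (cong (true ∷_) p≡q)
... | inj₂ p<q = inj₂ (s≤s p<q)
⊆⇒≡⊎∣∣< {p = false ∷ p} {false ∷ q} p⊆q with ⊆⇒≡⊎∣∣< (drop-∷-⊆ p⊆q)
... | inj₁ p≡q = inj₁ (cong (false ∷_) p≡q)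
... | inj₂ p<q = inj₂ p<q

-- A common element of `Q` and `I` is also one of `Q` and `J`, so no answer drops from 1 to 0.
answers-mono : ∀ {n s} {I J : Subset n} (Qs : Vec (Subset n) s) →
  I ⊆ J → map (𝒪 I) Qs ⊆ map (𝒪 J) Qs
answers-mono [] I⊆J = λ x∈ → x∈
answers-mono {I = I} {J} (Q ∷ Qs) I⊆J with nonempty? (Q ∩ I) | nonempty? (Q ∩ J)
... | no  _         | _     = out⊆ (answers-mono Qs I⊆J)
... | yes _         | yes _ = s⊆s (answers-mono Qs I⊆J)
... | yes (x , x∈Q∩I) | no Q∩J≡∅ with x∈p∩q⁻ Q I x∈Q∩I
...   | x∈Q , x∈I = contradiction (x , x∈p∩q⁺ (x∈Q , I⊆J x∈I)) Q∩J≡∅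

-- Estimating along a chain of sets of defective items

-- Otherwise the rational `m * a` lies below `D`, hence in the cut `m · α`, which yields `r` in `α`
-- with `m * a < m * r`, against `r ≤ a`.
estimate≤ : ∀ {α : Cut} {a D m} → (∀ {r} → α r → r ≤ + a / 1) →
  fromℤ D ≤ᶜ (+ m / 1) · α → D ℤ.≤ + (m ℕ.* a)
estimate≤ {α} {a} {D} {m} α≤a D≤mα = ℤ.≮⇒≥ λ ma<D → exceeds (D≤mα (/1-mono-< ma<D))
  where
  open ≤-Reasoning
  exceeds : ¬ ((+ m / 1) · α) (+ (m ℕ.* a) / 1)
  exceeds (r , αr , ma<mr) = <-irrefl refl (begin-strict
    + (m ℕ.* a) / 1        <⟨ ma<mr ⟩
    (+ m / 1) * r          ≤⟨ *-monoˡ-≤-nonNeg (+ m / 1) {{nonNegative (0≤/1 m)}} (α≤a αr) ⟩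
    (+ m / 1) * (+ a / 1)  ≡⟨ pos-/1-homo-* m a ⟨
    + (m ℕ.* a) / 1        ∎)

-- Double counting of the pairs `ω`, `j` with `good ω j`, weighted by the seed: each `j` collects at
-- least 2/3, and each seed counts at most `suc s` times.
chain⇒tests : ∀ {n s m} {α : Cut} {a} → (∀ {r} → α r → r ≤ + a / 1) →
  (I : Fin m → Subset n) →
  (∀ {i j} → i Fin.< j → I i ⊆ I j) →
  (∀ {i j} → i Fin.< j → ∣ I i ∣ ℕ.* a ℕ.< ∣ I j ∣) →
  (A : Algorithm n s) → Estimates (+ 2 / 3) α A → 2 ℕ.* m ℕ.≤ 3 ℕ.* suc s
chain⇒tests {n} {s} {m} {α} {a} α≤a I I-mono I-gap A est =
  ℤ.drop‿+≤+ (/1-cancel-≤ (begin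
    + (2 ℕ.* m) / 1                      ≡⟨ cong (λ x → + x / 1) (ℕ.*-comm 2 m) ⟩
    + (m ℕ.* 2) / 1                      ≡⟨ pos-/1-homo-* m 2 ⟩
    -- The factor 2 is rewritten as `(2 / 3) * 3` by evaluation alone.
    (+ m / 1) * ((+ 2 / 3) * (+ 3 / 1))  ≡⟨ *-assoc (+ m / 1) (+ 2 / 3) (+ 3 / 1) ⟨
    (+ m / 1) * (+ 2 / 3) * (+ 3 / 1)    ≤⟨ *-monoʳ-≤-nonNeg (+ 3 / 1) average ⟩
    (+ suc s / 1) * (+ 3 / 1)            ≡⟨ pos-/1-homo-* (suc s) 3 ⟨
    + (suc s ℕ.* 3) / 1                  ≡⟨ cong (λ x → + x / 1) (ℕ.*-comm (suc s) 3) ⟩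
    + (3 ℕ.* suc s) / 1                  ∎))
  where
  open ≤-Reasoning
  open Algorithm A

  G : Fin m → Subset seeds
  G j = proj₁ (est (I j))

  good : Fin seeds → Fin m → Bool
  good ω j = lookup (G j) ω

  answers : Fin seeds → Fin m → Subset s
  answers ω j = map (𝒪 (I j)) (tests ω)

  sound : ∀ {ω j} → good ω j ≡ true →
    (+ ∣ I j ∣ ℤ.≤ run (I j) ω) × (run (I j) ω ℤ.≤ + (∣ I j ∣ ℕ.* a))
  sound {ω} {j} gⱼ with proj₂ (proj₂ (est (I j))) (lookup⇒[]= ω (G j) gⱼ)
  ... | lo , hi = lo , estimate≤ {α} {m = ∣ I j ∣} α≤a hi

  -- Equal answers would produce one output for both sets, at most `∣ I i ∣ * a` by the one and at
  -- least `∣ I j ∣` by the other, contrary to the gap.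
  separated : ∀ ω {i j} → i Fin.< j → good ω i ≡ true → good ω j ≡ true →
    ∣ answers ω i ∣ ℕ.< ∣ answers ω j ∣
  separated ω {i} {j} i<j gᵢ gⱼ with ⊆⇒≡⊎∣∣< (answers-mono (tests ω) (I-mono i<j))
  ... | inj₂ less = less
  ... | inj₁ same = contradiction
    (ℤ.≤-trans (proj₁ (sound gⱼ)) (subst (ℤ._≤ _) (cong (output ω) same) (proj₂ (sound gᵢ))))
    (ℤ.<⇒≱ (ℤ.+<+ (I-gap i<j)))

  perSeed : ∀ ω → sum (λ j → if good ω j then weight ω else 0ℚ) ≤ (+ suc s / 1) * weight ω
  perSeed ω = subst (sum (λ j → if good ω j then weight ω else 0ℚ) ≤_) (∙≡/1* (suc s) (weight ω))
    -- The counts of positive answers range over 0, ..., `s`, so with `k = suc s` the lower bound of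
    -- the window holds automatically.
    (strictlyIncreasing⇒sum≤ (suc s) (λ j → ∣ answers ω j ∣) (good ω) (weight-nonNeg ω)
      (λ j → ∣p∣≤n (answers ω j)) (λ j _ → ℕ.m≤n+m (suc s) ∣ answers ω j ∣) (separated ω))

  average : (+ m / 1) * (+ 2 / 3) ≤ + suc s / 1
  average = begin
    (+ m / 1) * (+ 2 / 3)          ≡⟨ ∙≡/1* m (+ 2 / 3) ⟨
    m ∙ (+ 2 / 3)                  ≡⟨ Σℚ.sum-replicate m ⟨
    sum {m} (λ _ → + 2 / 3)        ≤⟨ sum-mono-≤ (λ j → proj₁ (proj₂ (est (I j)))) ⟩
    sum (λ j → probability (G j))  ≡⟨ Σℚ.∑-comm (λ j ω → if good ω j then weight ω else 0ℚ) ⟩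
    sum (λ ω → sum (λ j → if good ω j then weight ω else 0ℚ))
                                     ≤⟨ sum-mono-≤ perSeed ⟩
    sum (λ ω → (+ suc s / 1) * weight ω)
                                ≡⟨ Σℚ.*-distribˡ-sum (+ suc s / 1) weight ⟨
    (+ suc s / 1) * sum weight  ≡⟨ cong ((+ suc s / 1) *_) weight-total ⟩
    (+ suc s / 1) * 1ℚ          ≡⟨ *-identityʳ _ ⟩
    + suc s / 1                 ∎

-- A chain of geometrically growing sizes

n<2^n : ∀ n → n ℕ.< 2 ℕ.^ n
n<2^n zero    = s≤s z≤n
n<2^n (suc n) = ℕ.+-mono-≤ (ℕ.m^n>0 2 n) (ℕ.≤-trans (n<2^n n) (ℕ.m≤m+n _ 0))

-- The witness `m` is the number of powers of `B` up to `suc n`, that is, the rounded-down base-`B`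
-- logarithm plus one. In the induction it grows only when the next number reaches `B ^ m`.
enclosingPowers : ∀ {B} → 1 ℕ.< B → ∀ n →
  ∃ λ m → suc n ℕ.< B ℕ.^ m × (∀ {j} → j ℕ.< m → B ℕ.^ j ℕ.≤ suc n)
enclosingPowers {B} 1<B zero = 1 , ℕ.<-≤-trans 1<B (ℕ.m≤m*n B 1) , λ { (s≤s z≤n) → ℕ.≤-refl }
enclosingPowers {B} 1<B (suc n) with enclosingPowers 1<B n
... | m , n<B^m , h with suc (suc n) ℕ.<? B ℕ.^ m
...   | yes n<B^m′ = m , n<B^m′ , λ j<m → ℕ.m≤n⇒m≤1+n (h j<m)
...   | no  n≮B^m′ = suc m , ℕ.≤-<-trans n<B^m (ℕ.^-monoʳ-< B 1<B (ℕ.n<1+n m)) ,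
  λ { (s≤s j≤m) → ℕ.≤-trans (ℕ.^-monoʳ-≤ B {{ℕ.>-nonZero (ℕ.<-trans (s≤s z≤n) 1<B)}} j≤m) (ℕ.≮⇒≥ n≮B^m′) }

module _ (a : ℕ) where

  private
    -- A power of two turns `B ^ m` directly into a base-2 bound; the exponent `suc a` makes `B`
    -- exceed `a`, and also 1 when `a = 0`.
    e B : ℕ
    e = suc a
    B = 2 ℕ.^ e

    1<B : 1 ℕ.< B
    1<B = ℕ.≤-<-trans (s≤s z≤n) (n<2^n e)

  -- This is `log n ≤ 3 * e * s` with the logarithm cleared, obtained from `n < B ^ m` and
  -- `m ≤ 3 * s` for the chain of length `m`.
  logarithmicallyManyTests : ∀ {n s} {α : Cut} → (∀ {r} → α r → r ≤ + a / 1) → n ≥ B →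
    (A : Algorithm n s) → Estimates (+ 2 / 3) α A → n ℕ.≤ 2 ℕ.^ (3 ℕ.* e ℕ.* s)
  logarithmicallyManyTests {zero} _ _ _ _ = z≤n
  logarithmicallyManyTests {n@(suc n-1)} {s} α≤a n≥B A est with enclosingPowers 1<B n-1
  ... | m , n<B^m , B^j≤n = begin
    n                        ≤⟨ ℕ.<⇒≤ n<B^m ⟩
    B ℕ.^ m                  ≡⟨ ℕ.^-*-assoc 2 e m ⟩
    2 ℕ.^ (e ℕ.* m)          ≤⟨ ℕ.^-monoʳ-≤ 2 (ℕ.*-monoʳ-≤ e (m≤3s m s 2≤m 2m≤3[1+s])) ⟩
    2 ℕ.^ (e ℕ.* (3 ℕ.* s))  ≡⟨ cong (2 ℕ.^_) (rearrange e s) ⟩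
    2 ℕ.^ (3 ℕ.* e ℕ.* s)    ∎
    where
    open ℕ.≤-Reasoning

    rearrange : ∀ e s → e ℕ.* (3 ℕ.* s) ≡ 3 ℕ.* e ℕ.* s
    rearrange = solve-∀

    2≤m : 2 ℕ.≤ m
    2≤m = ℕ.≰⇒> λ m≤1 → ℕ.<⇒≱ n<B^m
      (ℕ.≤-trans (ℕ.^-monoʳ-≤ B {{ℕ.m^n≢0 2 e}} m≤1) (ℕ.≤-trans (ℕ.≤-reflexive (ℕ.*-identityʳ B)) n≥B))

    -- Absorbs the additive constant of `suc s`: two chain members already exclude `s = 0`, and for
    -- positive `s` one has `3 * (s + 1) ≤ 6 * s`.
    m≤3s : ∀ m s → 2 ℕ.≤ m → 2 ℕ.* m ℕ.≤ 3 ℕ.* suc s → m ℕ.≤ 3 ℕ.* s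
    m≤3s m zero    2≤m h = contradiction (ℕ.≤-trans (ℕ.*-monoʳ-≤ 2 2≤m) h) (ℕ.<⇒≱ (ℕ.n<1+n 3))
    m≤3s m (suc s) 2≤m h = ℕ.*-cancelˡ-≤ 2 (ℕ.≤-trans h
      (ℕ.≤-trans (ℕ.m≤m+n _ (3 ℕ.* s)) (ℕ.≤-reflexive (double s))))
      where
      double : ∀ s → 3 ℕ.* suc (suc s) ℕ.+ 3 ℕ.* s ≡ 2 ℕ.* (3 ℕ.* suc s)
      double = solve-∀

    I : Fin m → Subset n
    I j = initial (B ℕ.^ toℕ j)

    ∣I∣ : ∀ j → ∣ I j ∣ ≡ B ℕ.^ toℕ j
    ∣I∣ j = ∣initial∣ (B^j≤n (Fin.toℕ<n j))

    I-mono : ∀ {i j} → i Fin.< j → I i ⊆ I j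
    I-mono i<j = initial-mono (ℕ.^-monoʳ-≤ B {{ℕ.m^n≢0 2 e}} (ℕ.<⇒≤ i<j))

    I-gap : ∀ {i j} → i Fin.< j → ∣ I i ∣ ℕ.* a ℕ.< ∣ I j ∣
    I-gap {i} {j} i<j rewrite ∣I∣ i | ∣I∣ j = begin-strict
      B ℕ.^ toℕ i ℕ.* a  <⟨ ℕ.*-monoʳ-< (B ℕ.^ toℕ i) a<B ⟩
      B ℕ.^ toℕ i ℕ.* B  ≡⟨ ℕ.*-comm (B ℕ.^ toℕ i) B ⟩
      B ℕ.^ suc (toℕ i)  ≤⟨ ℕ.^-monoʳ-≤ B {{ℕ.m^n≢0 2 e}} i<j ⟩
      B ℕ.^ toℕ j        ∎
      where
      a<B : a ℕ.< B
      a<B = ℕ.<-trans (ℕ.n<1+n a) (n<2^n e)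
      instance
        B^i≢0 = ℕ.m^n≢0 B (toℕ i) {{ℕ.m^n≢0 2 e}}

    2m≤3[1+s] : 2 ℕ.* m ℕ.≤ 3 ℕ.* suc s
    2m≤3[1+s] = chain⇒tests α≤a I I-mono I-gap A est

-- The quotient of logarithms and the final constants

-- Any `t` outside `y` is at least 1, so `q ≥ L ≥ 0` would give `q ≤ q * t < r < L`.
÷-upper : ∀ {x y : Cut} L → (∀ {r} → x r → r < + L / 1) → (∀ {t} → t < 1ℚ → y t) →
  ∀ {q} → (x ÷ y) q → q < + L / 1
÷-upper L x<L 1≤y {q} (r , t , xr , 0<t , ¬yt , qt<r) = ≰⇒> λ L≤q → <-irrefl refl (begin-strict
  q        ≡⟨ *-identityʳ q ⟨
  q * 1ℚ   ≤⟨ *-monoˡ-≤-nonNeg q {{nonNegative (≤-trans (0≤/1 L) L≤q)}} (≮⇒≥ (¬yt ∘ 1≤y)) ⟩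
  q * t    <⟨ qt<r ⟩
  r        <⟨ x<L xr ⟩
  + L / 1  ≤⟨ L≤q ⟩
  q        ∎)
  where open ≤-Reasoning

mainTheorem2 : (k : ℕ) → k ≥ 1 → (α : Cut) → IsReal α →
    ∃₂ λ (c : ℚ) (n₀ : ℕ) → 0ℚ < c ×
    (∀ (n : ℕ) → n ≥ n₀ → ∀ (s : ℕ) (A : Algorithm n s) →
    Estimates (+ 2 / 3) α A →
    c · (log (fromℕ n) ÷ log^[ k ] (fromℕ n)) ≤ᶜ fromℕ s)
mainTheorem2 (suc k) _ α α-real
  with q₀ , ¬αq₀ ← IsReal.bounded α-real
  with a , q₀<a ← archimedean q₀
  -- Once the `k`-fold logarithm exceeds 2, one more logarithm contains every rational below 1, as
  -- `÷-upper` requires of the denominator.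
  with n₁ , log-large ← log^[]-unbounded k (2ℚ ^ 1) =
  -- `d = 3 * (a + 1)` is the factor in `n ≤ 2 ^ (d * s)`; the threshold ensures both `n ≥ B` and a
  -- denominator of at least 1.
  1/ d , 2 ℕ.^ suc a ℕ.⊔ n₁ , positive⁻¹ (1/ d) , bound
  where
  d : ℚ
  d = mkℚ (+ (3 ℕ.* suc a)) 0 (Coprimality.sym (Coprimality.1-coprimeTo (3 ℕ.* suc a)))

  α≤a : ∀ {r} → α r → r ≤ + a / 1
  α≤a αr = ≮⇒≥ λ a<r → ¬αq₀ (IsReal.downward α-real (<-trans q₀<a a<r) αr)

  bound : ∀ n → n ≥ 2 ℕ.^ suc a ℕ.⊔ n₁ → ∀ s (A : Algorithm n s) → Estimates (+ 2 / 3) α A →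
    (1/ d) · (log (fromℕ n) ÷ log^[ suc k ] (fromℕ n)) ≤ᶜ fromℕ s
  bound n n≥n₀ s A est {q} (r , r<log÷log , q<r/d) = begin-strict
    q                                   <⟨ q<r/d ⟩
    1/ d * r                            ≤⟨ *-monoˡ-≤-nonNeg (1/ d) (<⇒≤ r<ds) ⟩
    1/ d * (+ (3 ℕ.* suc a ℕ.* s) / 1)  ≡⟨ cong (1/ d *_) (pos-/1-homo-* (3 ℕ.* suc a) s) ⟩
    1/ d * ((+ (3 ℕ.* suc a) / 1) * (+ s / 1))
                            ≡⟨ cong (λ x → 1/ d * (x * (+ s / 1))) (z/1≡mkℚ (+ (3 ℕ.* suc a))) ⟩
    1/ d * (d * (+ s / 1))  ≡⟨ *-assoc (1/ d) d (+ s / 1) ⟨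
    1/ d * d * (+ s / 1)    ≡⟨ cong (_* (+ s / 1)) (*-inverseˡ d) ⟩
    1ℚ * (+ s / 1)          ≡⟨ *-identityˡ _ ⟩
    + s / 1                 ∎
    where
    open ≤-Reasoning
    n≤2^ds : n ℕ.≤ 2 ℕ.^ (3 ℕ.* suc a ℕ.* s)
    n≤2^ds = logarithmicallyManyTests a α≤a (ℕ.≤-trans (ℕ.m≤m⊔n _ n₁) n≥n₀) A est
    r<ds : r < + (3 ℕ.* suc a ℕ.* s) / 1
    r<ds = ÷-upper {x = log (fromℕ n)} {y = log^[ suc k ] (fromℕ n)} (3 ℕ.* suc a ℕ.* s)
      (log-upper (3 ℕ.* suc a ℕ.* s) n≤2^ds)
      (log-lower 1 (log-large n (ℕ.≤-trans (ℕ.m≤n⊔m (2 ℕ.^ suc a) n₁) n≥n₀))) r<log÷log
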